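{- Let $k\ge 1$. The numbers $S_{k}(n;m',u')$ with $m',u'\in\{0,1\}$ enumerate the following combinatorial objects. (1) $S_{k}(n;0,0)=|\mathtt{Dyck}(n;k)|$, which is the Fuss–Catalan number $\frac{1}{kn+1}\binom{(k+1)n}{n}$. (2) $S_{k}(n;0,1)=2^{n}|\mathtt{Dyck}(n;k)|$, namely the number of $k$-Dyck paths of size $n$ with two colors for each up step. (3) $S_{k}(n;1,0)$ is the number of $k$-Schröder paths of type A of size $n$, that is, $|\mathtt{Sch}^{A}(n;k)|$. (4) $S_{k}(n;1,1)$ is the weighted number of $k$-Dyck paths $\mu$ of size $n$ in which each up step beginning a pattern $UD^{k}$ has weight $4$ and each other up step has weight $3$ (the weight of $\mu$ being the product of the weights of its up steps).
   Context: Let $\nu(m,r,s,u)$ be the formal power series in $r$ satisfying $f(rs)\nu(m,r,s,u)=1-g(rs)\prod_{j=0}^{k}\nu(m,rs^{j},s,u)$, where $f(x)=1+x(m-1)$ and $g(x)=x(m(u-1)+1)$. With $m'=m-1$ and $u'=u-1$, the numbers $S_k(n;m',u')$ are defined by the expansion at $s=1$: $\nu(m,r,1,u)=\sum_{n\ge 0}(-r)^{n}S_{k}(n;m',u')$. A $k$-Dyck path of size $n$ is a lattice path from $(0,0)$ to $(kn,n)$ consisting of up steps $U=(0,1)$ and down steps $D=(1,0)$ which never goes below the line $y=x/k$; $\mathtt{Dyck}(n;k)$ is the set of them. A $k$-Schröder path of type A of size $n$ is a lattice path from $(0,0)$ to $(kn,n)$ with steps $U=(0,1)$, $D=(1,0)$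 and $H=(k,1)$, which never goes below $y=x/k$; $\mathtt{Sch}^{A}(n;k)$ is the set of them. -}

module Defs where

open import Data.Bool.Base using (if_then_else_)
open import Data.Fin.Base using (Fin; toℕ; zero; suc)
open import Data.Integer.Base using (ℤ; +_; 0ℤ; 1ℤ; _+_; _-_; -_; _*_; _^_)
import Data.Integer.Properties as ℤₚ
open import Data.Integer.Tactic.RingSolver using (solve-∀)
open import Data.List.Base using (List; []; _∷_; replicate; foldl)
open import Data.List.Relation.Binary.Prefix.Heterogeneous.Properties using (prefix?)
open import Data.List.Relation.Unary.All using (All)
open import Data.Nat.Base as ℕ using (ℕ; zero; suc; _∸_; _≤_; _<_; s≤s)
open import Data.Nat.Combinatorics using (_C_)
import Data.Nat.Properties as ℕₚ
open import Data.Product.Base using (Σ; Σ-syntax; _×_; _,_)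
open import Data.Rational.Base as ℚ using (ℚ)
import Data.Fin.Properties as Finₚ
open import Function.Base using (_∘_)
open import Function.Bundles using (_↔_; Inverse)
open import Relation.Binary.Definitions using (DecidableEquality)
open import Relation.Binary.PropositionalEquality
open import Relation.Nullary.Decidable.Core using (does; yes; no)
open import Algebra.Properties.Monoid.Sum ℤₚ.+-0-monoid using (sum; sum-cong-≗; sum-replicate-zero)
open import Algebra.Definitions.RawMonoid ℕ.+-0-rawMonoid using () renaming (sum to sumℕ)

-- a n is the coefficient of the n-th power of the variable; series are
-- compared coefficientwise (_≗_).
PowerSeries : Set
PowerSeries = ℕ → ℤ

linear : ℤ → ℤ → PowerSeries
linear a b zero          = a
linear a b (suc zero)    = b
linear a b (suc (suc _)) = 0ℤ

one : PowerSeries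
one = linear 1ℤ 0ℤ

infixl 6 _⊖_
infixl 7 _⊛_

_⊖_ : PowerSeries → PowerSeries → PowerSeries
(a ⊖ b) n = a n - b n

_⊛_ : PowerSeries → PowerSeries → PowerSeries
(a ⊛ b) n = sum {suc n} (λ i → a (toℕ i) * b (n ∸ toℕ i))

-- The substitution x ↦ c x.
dilate : ℤ → PowerSeries → PowerSeries
dilate c a n = c ^ n * a n

∏≤ : ℕ → (ℕ → PowerSeries) → PowerSeries
∏≤ zero    F = F zero
∏≤ (suc k) F = ∏≤ k F ⊛ F (suc k)

f : ℤ → PowerSeries
f m = linear 1ℤ (m - 1ℤ)

g : ℤ → ℤ → PowerSeries
g m u = linear 0ℤ (m * (u - 1ℤ) + 1ℤ)

-- The parameters m, s, u range over ℤ, and ν m s u is the power series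
-- ν(m,r,s,u) in r:
--   f(rs) ν(m,r,s,u) = 1 - g(rs) ∏_{j=0}^{k} ν(m,rs^j,s,u).
IsNu : ℕ → (ℤ → ℤ → ℤ → PowerSeries) → Set
IsNu k ν = ∀ m s u →
  dilate s (f m) ⊛ ν m s u
    ≗ one ⊖ dilate s (g m u) ⊛ ∏≤ k (λ j → dilate (s ^ j) (ν m s u))

-- ν(m,r,1,u) = Σ_n (-r)^n S(n; m-1, u-1).
IsExpansionAt1 : (ℤ → ℤ → ℤ → PowerSeries) → (ℕ → ℤ → ℤ → ℤ) → Set
IsExpansionAt1 ν S = ∀ m u →
  ν m 1ℤ u ≗ dilate (- 1ℤ) (λ n → S n (m - 1ℤ) (u - 1ℤ))

Point : Set
Point = ℕ × ℕ

infixl 6 _⊕_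

_⊕_ : Point → Point → Point
(x , y) ⊕ (x′ , y′) = (x ℕ.+ x′ , y ℕ.+ y′)

module _ {Step : Set} (δ : Step → Point) where

  endpoint : Point → List Step → Point
  endpoint = foldl (λ p s → p ⊕ δ s)

  vertices : Point → List Step → List Point
  vertices p []      = p ∷ []
  vertices p (s ∷ w) = p ∷ vertices (p ⊕ δ s) w

-- (x , y) is not below the line y = x/k, for k ≥ 1.
NotBelow : ℕ → Point → Set
NotBelow k (x , y) = x ≤ k ℕ.* y

-- Paths from (0,0) to (kn,n) with displacement δ s for each step s.  As the
-- steps are straight, being weakly above the line is a condition on vertices.
-- The conditions are irrelevant, so a path is determined by its steps.
record Path {Step : Set} (δ : Step → Point) (k n : ℕ) : Set where
  constructor mkPath
  field
    steps   : List Step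
    .ends   : endpoint δ (0 , 0) steps ≡ (k ℕ.* n , n)
    .weakly : All (NotBelow k) (vertices δ (0 , 0) steps)

data DyckStep : Set where
  U D : DyckStep

δDyck : DyckStep → Point
δDyck U = (0 , 1)
δDyck D = (1 , 0)

Dyck : ℕ → ℕ → Set
Dyck n k = Path δDyck k n

data SchröderStep : Set where
  U D H : SchröderStep

δSchröder : ℕ → SchröderStep → Point
δSchröder k U = (0 , 1)
δSchröder k D = (1 , 0)
δSchröder k H = (k , 1)

SchA : ℕ → ℕ → Set
SchA n k = Path (δSchröder k) k n

data ColouredStep : Set where
  U : Fin 2 → ColouredStep
  D : ColouredStep

δColoured : ColouredStep → Point
δColoured (U _) = (0 , 1)
δColoured D     = (1 , 0)

ColouredDyck : ℕ → ℕ → Set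
ColouredDyck n k = Path δColoured k n

_≟_ : DecidableEquality DyckStep
U ≟ U = yes refl
U ≟ D = no λ ()
D ≟ U = no λ ()
D ≟ D = yes refl

wordWeight : ℕ → List DyckStep → ℕ
wordWeight k []      = 1
wordWeight k (D ∷ w) = wordWeight k w
wordWeight k (U ∷ w) =
  (if does (prefix? _≟_ (replicate k D) w) then 4 else 3) ℕ.* wordWeight k w

weight : ∀ {n k} → Dyck n k → ℕ
weight {k = k} μ = wordWeight k (Path.steps μ)

HasCardinality : Set → ℕ → Set
HasCardinality A c = Fin c ↔ A

-- A is finite and the sum of w over A is c; the value of the sum does not
-- depend on the enumeration e.
HasWeightedCount : (A : Set) → (A → ℕ) → ℕ → Set
HasWeightedCount A w c =
  Σ[ N ∈ ℕ ] Σ[ e ∈ Fin N ↔ A ] sumℕ (w ∘ Inverse.to e) ≡ c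

fussCatalan : ℕ → ℕ → ℚ
fussCatalan k n =
  (+ 1 ℚ./ suc (k ℕ.* n)) ℚ.* (+ ((suc k ℕ.* n) C n) ℚ./ 1)

private
  ⊛-cong : ∀ (a a′ b b′ : PowerSeries) n → (∀ i → i ≤ n → a i ≡ a′ i) →
           (∀ i → i ≤ n → b i ≡ b′ i) → (a ⊛ b) n ≡ (a′ ⊛ b′) n
  ⊛-cong a a′ b b′ n p q = sum-cong-≗ {suc n} λ i →
    cong₂ _*_ (p (toℕ i) (ℕₚ.≤-pred (Finₚ.toℕ<n i))) (q _ (ℕₚ.m∸n≤m n (toℕ i)))

  ∏-cong : ∀ k s (a b : PowerSeries) n → (∀ i → i ≤ n → a i ≡ b i) →
           ∏≤ k (λ j → dilate (s ^ j) a) n ≡ ∏≤ k (λ j → dilate (s ^ j) b) n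
  ∏-cong zero    s a b n p = cong ((s ^ 0) ^ n *_) (p n ℕₚ.≤-refl)
  ∏-cong (suc k) s a b n p = ⊛-cong
    (∏≤ k (λ j → dilate (s ^ j) a)) (∏≤ k (λ j → dilate (s ^ j) b))
    (dilate (s ^ suc k) a) (dilate (s ^ suc k) b) n
    (λ i i≤n → ∏-cong k s a b i (λ j j≤i → p j (ℕₚ.≤-trans j≤i i≤n)))
    (λ i i≤n → cong ((s ^ suc k) ^ i *_) (p i i≤n))

  linear-⊛-zero : ∀ s a b x → (dilate s (linear a b) ⊛ x) 0 ≡ a * x 0
  linear-⊛-zero s a b x = lemma a (x 0)
    where
    lemma : ∀ a y → 1ℤ * a * y + 0ℤ ≡ a * y
    lemma = solve-∀

  linear-⊛-suc : ∀ s a b x n →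
    (dilate s (linear a b) ⊛ x) (suc n) ≡ a * x (suc n) + s * b * x n
  linear-⊛-suc s a b x n = trans
    (cong (λ t → 1ℤ * a * x (suc n) + (s * 1ℤ * b * x n + t)) tail≡0)
    (lemma s a b (x (suc n)) (x n))
    where
    tail≡0 : sum {n} (λ i → s ^ suc (suc (toℕ i)) * 0ℤ * x (suc n ∸ suc (suc (toℕ i)))) ≡ 0ℤ
    tail≡0 = trans
      (sum-cong-≗ {n} λ i → cong (_* x (suc n ∸ suc (suc (toℕ i))))
                          (ℤₚ.*-zeroʳ (s ^ suc (suc (toℕ i)))))
      (sum-replicate-zero n)
    lemma : ∀ s a b y z → 1ℤ * a * y + (s * 1ℤ * b * z + 0ℤ) ≡ a * y + s * b * z
    lemma = solve-∀

module Solution (k : ℕ) (m s u : ℤ) where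

  private
    c : ℤ
    c = m * (u - 1ℤ) + 1ℤ

    P : PowerSeries → PowerSeries
    P a = ∏≤ k (λ j → dilate (s ^ j) a)

    Φ : PowerSeries → PowerSeries
    Φ a zero    = 1ℤ
    Φ a (suc n) = - (s * (m - 1ℤ) * a n) - s * c * P a n

    approx : ℕ → PowerSeries
    approx zero    = λ _ → 0ℤ
    approx (suc N) = Φ (approx N)

    Φ-cong : ∀ (a b : PowerSeries) n → (∀ i → i ≤ n → a i ≡ b i) → Φ a (suc n) ≡ Φ b (suc n)
    Φ-cong a b n p = cong₂ (λ y z → - (s * (m - 1ℤ) * y) - s * c * z)
                       (p n ℕₚ.≤-refl) (∏-cong k s a b n p)

    agree : ∀ N M i → i < N → i < M → approx N i ≡ approx M i
    agree (suc N) (suc M) zero    _         _         = refl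
    agree (suc N) (suc M) (suc i) (s≤s i<N) (s≤s i<M) = Φ-cong (approx N) (approx M) i λ j j≤i →
      agree N M j (ℕₚ.≤-<-trans j≤i i<N) (ℕₚ.≤-<-trans j≤i i<M)

  series : PowerSeries
  series n = approx (suc n) n

  private
    unfold : ∀ n → series (suc n) ≡ Φ series (suc n)
    unfold n = Φ-cong (approx (suc n)) series n λ i i≤n → agree (suc n) (suc i) i (s≤s i≤n) ℕₚ.≤-refl

  equation : dilate s (f m) ⊛ series ≗ one ⊖ dilate s (g m u) ⊛ P series
  equation zero = trans (linear-⊛-zero s 1ℤ (m - 1ℤ) series)
    (sym (trans (cong (λ t → 1ℤ - t) (linear-⊛-zero s 0ℤ c (P series))) (lemma (P series 0))))
    where
    lemma : ∀ y → 1ℤ - 0ℤ * y ≡ 1ℤ * 1ℤ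
    lemma = solve-∀
  equation (suc n) = begin
    (dilate s (f m) ⊛ series) (suc n)
      ≡⟨ linear-⊛-suc s 1ℤ (m - 1ℤ) series n ⟩
    1ℤ * series (suc n) + s * (m - 1ℤ) * series n
      ≡⟨ cong (λ t → 1ℤ * t + s * (m - 1ℤ) * series n) (unfold n) ⟩
    1ℤ * Φ series (suc n) + s * (m - 1ℤ) * series n
      ≡⟨ lemma (s * (m - 1ℤ) * series n) (s * c) (P series n) (P series (suc n)) ⟩
    0ℤ - (0ℤ * P series (suc n) + s * c * P series n)
      ≡⟨ cong₂ _-_ (one-suc n) (linear-⊛-suc s 0ℤ c (P series) n) ⟨
    (one ⊖ dilate s (g m u) ⊛ P series) (suc n) ∎
    where
    open ≡-Reasoning
    one-suc : ∀ n → one (suc n) ≡ 0ℤ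
    one-suc zero    = refl
    one-suc (suc n) = refl
    lemma : ∀ y a p q → 1ℤ * (- y - a * p) + y ≡ 0ℤ - (0ℤ * q + a * p)
    lemma = solve-∀

ν-exists : ∀ k → Σ[ ν ∈ (ℤ → ℤ → ℤ → PowerSeries) ] IsNu k ν
ν-exists k = Solution.series k , Solution.equation k

module Submission where

-- At s = 1 and r = -x the series T = Σ S(n) xⁿ satisfies T = 1 + m′ x T + c x T ^ (k + 1) with
-- c = (m′ + 1) u′ + 1, so the coefficients of all powers T ^ j obey a triangular recursion in
-- (n , j) that determines them.  Lattice words descending from height h = j - 1 to 0, split
-- at their first step, obey the same recursion: a step D turns j into j - 1, a step U turns j
-- into j + k, and a step H keeps j.  For the weight 4 = 3 + 1 the additional 1 counts the words
-- in which U is followed by Dᵏ; the block U Dᵏ then acts as a step H.  The Fuss–Catalan formula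
-- is the case j = 1 of a ballot-type formula for the coefficients of T ^ j with m′ = 0, c = 1.

open import Defs
open import Data.Bool.Base using (true; false; if_then_else_)
open import Data.Fin.Base using (Fin; zero; suc; toℕ)
open import Data.Integer.Base as ℤ using (ℤ; +_; 0ℤ; 1ℤ; -1ℤ)
import Data.Integer.Properties as ℤ
import Data.Integer.Tactic.RingSolver as ℤ-Solver
open import Data.List.Base using (List; []; _∷_; _++_; map; concatMap; length; lookup; replicate)
open import Data.List.Properties using (map-++; map-∘; map-cong; length-map; length-++; ++-identityʳ; ∷-injectiveʳ)
open import Data.List.Membership.Propositional using (_∈_; find; lose)
open import Data.List.Membership.Propositional.Properties using (∈-++⁺ˡ; ∈-++⁺ʳ; ∈-++⁻; ∈-map⁺; ∈-map⁻; ∈-concatMap⁺; ∈-concatMap⁻; ∈-lookup)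
open import Data.List.Relation.Binary.Disjoint.Propositional using (Disjoint)
open import Data.List.Relation.Binary.Prefix.Heterogeneous.Properties using (prefix?)
open import Data.List.Relation.Unary.All as All using (All; []; _∷_; all?)
import Data.List.Relation.Unary.All.Properties as All
open import Data.List.Relation.Unary.AllPairs as AllPairs using ([]; _∷_)
import Data.List.Relation.Unary.AllPairs.Properties as AllPairs
open import Data.List.Relation.Unary.Any using (here; there; index)
open import Data.List.Relation.Unary.Any.Properties using (lookup-index)
open import Data.List.Relation.Unary.Unique.Propositional using (Unique)
import Data.List.Relation.Unary.Unique.Propositional.Properties as Unique
open import Data.Nat.Base using (ℕ; zero; suc; _+_; _*_; _∸_; _^_; _≤_; z<s)
open import Data.Nat.Combinatorics using (_C_; nC1≡n; nCk+nC[k+1]≡[n+1]C[k+1]; k>n⇒nCk≡0)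
open import Data.Nat.ListAction using (sum)
open import Data.Nat.ListAction.Properties using (sum-++)
import Data.Nat.Properties as ℕ
open import Data.Nat.Tactic.RingSolver using (solve-∀)
open import Data.Product.Base using (Σ-syntax; ∃-syntax; _×_; _,_; proj₁; proj₂)
open import Data.Product.Properties using (≡-dec)
open import Data.Rational.Base as ℚ using (_/_)
import Data.Rational.Properties as ℚ
open import Data.Rational.Unnormalised.Base as ℚᵘ using (mkℚᵘ; *≡*)
import Data.Rational.Unnormalised.Properties as ℚᵘ
open import Data.Sum.Base using (inj₁; inj₂)
open import Function.Base using (_∘_)
open import Function.Bundles using (_↔_; mk↔ₛ′)
open import Relation.Binary.PropositionalEquality
open import Relation.Nullary.Decidable using (does; recompute)
open import Relation.Nullary.Negation using (¬_; contradiction)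
open import Algebra.Definitions.RawMonoid Data.Nat.Base.+-0-rawMonoid using () renaming (sum to sumℕ)
open import Algebra.Properties.Monoid.Sum ℤ.+-0-monoid using (sum-cong-≗)

-- Coefficients of powers of the series T.

-- The coefficient of xⁿ in T ^ j, where T = 1 + m′ x T + c x T ^ (k + 1).
coeff : ℕ → ℕ → ℕ → ℕ → ℕ → ℕ
coeff k m′ c zero    zero    = 1
coeff k m′ c zero    (suc n) = 0
coeff k m′ c (suc j) zero    = coeff k m′ c j zero
coeff k m′ c (suc j) (suc n) =
  coeff k m′ c j (suc n) + (m′ * coeff k m′ c (suc j) n + c * coeff k m′ c (suc (k + j)) n)

-- With `m′ = 0` every unfolding that lowers `n` contributes exactly one factor `c`, so a factor `a`
-- of it comes out `n` times. For `a = 2` this accounts for the two colours of each up step.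
coeff-scale : ∀ k a c j n → coeff k 0 (a * c) j n ≡ a ^ n * coeff k 0 c j n
coeff-scale k a c zero    zero    = refl
coeff-scale k a c zero    (suc n) = sym (ℕ.*-zeroʳ (a ^ suc n))
coeff-scale k a c (suc j) zero    = coeff-scale k a c j zero
coeff-scale k a c (suc j) (suc n) = trans
  (cong₂ (λ x y → x + a * c * y) (coeff-scale k a c j (suc n)) (coeff-scale k a c (suc (k + j)) n))
  (regroup a (a ^ n) c (coeff k 0 c j (suc n)) (coeff k 0 c (suc (k + j)) n))
  where
  regroup : ∀ a p c x y → a * p * x + a * c * (p * y) ≡ a * p * (x + c * y)
  regroup = solve-∀

-- The convolution product.

⊛-cong : ∀ {a a′ b b′} → a ≗ a′ → b ≗ b′ → a ⊛ b ≗ a′ ⊛ b′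
⊛-cong a≗ b≗ n = sum-cong-≗ {suc n} λ i → cong₂ ℤ._*_ (a≗ (toℕ i)) (b≗ (n ∸ toℕ i))

⊛-linearˡ : ∀ p q a b d n →
  ((λ i → p ℤ.* a i ℤ.+ q ℤ.* b i) ⊛ d) n ≡ p ℤ.* (a ⊛ d) n ℤ.+ q ℤ.* (b ⊛ d) n
⊛-linearˡ p q a b d zero    = distrib p q (a 0) (b 0) (d 0)
  where
  distrib : ∀ p q x y z → (p ℤ.* x ℤ.+ q ℤ.* y) ℤ.* z ℤ.+ 0ℤ
    ≡ p ℤ.* (x ℤ.* z ℤ.+ 0ℤ) ℤ.+ q ℤ.* (y ℤ.* z ℤ.+ 0ℤ)
  distrib = ℤ-Solver.solve-∀
⊛-linearˡ p q a b d (suc n) = trans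
  (cong (λ t → (p ℤ.* a 0 ℤ.+ q ℤ.* b 0) ℤ.* d (suc n) ℤ.+ t) (⊛-linearˡ p q (a ∘ suc) (b ∘ suc) d n))
  (distrib p q (a 0) (b 0) (d (suc n)) (((a ∘ suc) ⊛ d) n) (((b ∘ suc) ⊛ d) n))
  where
  distrib : ∀ p q x y z v w → (p ℤ.* x ℤ.+ q ℤ.* y) ℤ.* z ℤ.+ (p ℤ.* v ℤ.+ q ℤ.* w)
    ≡ p ℤ.* (x ℤ.* z ℤ.+ v) ℤ.+ q ℤ.* (y ℤ.* z ℤ.+ w)
  distrib = ℤ-Solver.solve-∀

-- The shift of `a ⊛ b` is `a 0` times the shift of `b`, plus `(a ∘ suc) ⊛ b`. Linearity in the left
-- factor therefore reduces the claim to the shorter convolution with `a ∘ suc`.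
⊛-assoc : ∀ a b d → (a ⊛ b) ⊛ d ≗ a ⊛ (b ⊛ d)
⊛-assoc a b d zero    = assoc (a 0) (b 0) (d 0)
  where
  assoc : ∀ x y z → (x ℤ.* y ℤ.+ 0ℤ) ℤ.* z ℤ.+ 0ℤ ≡ x ℤ.* (y ℤ.* z ℤ.+ 0ℤ) ℤ.+ 0ℤ
  assoc = ℤ-Solver.solve-∀
⊛-assoc a b d (suc n) = begin
  (a 0 ℤ.* b 0 ℤ.+ 0ℤ) ℤ.* d (suc n) ℤ.+ (((a ⊛ b) ∘ suc) ⊛ d) n
    ≡⟨ cong (λ t → (a 0 ℤ.* b 0 ℤ.+ 0ℤ) ℤ.* d (suc n) ℤ.+ t) (begin
      (((a ⊛ b) ∘ suc) ⊛ d) n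
        -- The factor `1ℤ` is inserted to bring the sum into the shape of `⊛-linearˡ`.
        ≡⟨ ⊛-cong {b = d} (λ i → cong (λ t → a 0 ℤ.* b (suc i) ℤ.+ t) (sym (ℤ.*-identityˡ (((a ∘ suc) ⊛ b) i)))) (λ _ → refl) n ⟩
      ((λ i → a 0 ℤ.* b (suc i) ℤ.+ 1ℤ ℤ.* ((a ∘ suc) ⊛ b) i) ⊛ d) n
        ≡⟨ ⊛-linearˡ (a 0) 1ℤ (b ∘ suc) ((a ∘ suc) ⊛ b) d n ⟩
      a 0 ℤ.* ((b ∘ suc) ⊛ d) n ℤ.+ 1ℤ ℤ.* (((a ∘ suc) ⊛ b) ⊛ d) n
        ≡⟨ cong (λ t → a 0 ℤ.* ((b ∘ suc) ⊛ d) n ℤ.+ 1ℤ ℤ.* t) (⊛-assoc (a ∘ suc) b d n) ⟩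
      a 0 ℤ.* ((b ∘ suc) ⊛ d) n ℤ.+ 1ℤ ℤ.* ((a ∘ suc) ⊛ (b ⊛ d)) n ∎) ⟩
  (a 0 ℤ.* b 0 ℤ.+ 0ℤ) ℤ.* d (suc n) ℤ.+ (a 0 ℤ.* ((b ∘ suc) ⊛ d) n ℤ.+ 1ℤ ℤ.* ((a ∘ suc) ⊛ (b ⊛ d)) n)
    ≡⟨ regroup (a 0) (b 0) (d (suc n)) _ _ ⟩
  a 0 ℤ.* (b 0 ℤ.* d (suc n) ℤ.+ ((b ∘ suc) ⊛ d) n) ℤ.+ ((a ∘ suc) ⊛ (b ⊛ d)) n ∎
  where
  open ≡-Reasoning
  regroup : ∀ x y z v w → (x ℤ.* y ℤ.+ 0ℤ) ℤ.* z ℤ.+ (x ℤ.* v ℤ.+ 1ℤ ℤ.* w) ≡ x ℤ.* (y ℤ.* z ℤ.+ v) ℤ.+ w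
  regroup = ℤ-Solver.solve-∀

-- The hypotheses on `a` are pointwise so that the induction can pass to `a ∘ suc`, a constant
-- series with value 0.
constant-⊛ : ∀ {a} p → a 0 ≡ p → (∀ i → a (suc i) ≡ 0ℤ) → ∀ b → a ⊛ b ≗ λ n → p ℤ.* b n
constant-⊛ {a} p refl a≡0 b zero    = ℤ.+-identityʳ (a 0 ℤ.* b 0)
constant-⊛ {a} p refl a≡0 b (suc n) = trans
  (cong (λ t → a 0 ℤ.* b (suc n) ℤ.+ t) (constant-⊛ {a ∘ suc} 0ℤ (a≡0 0) (a≡0 ∘ suc) b n))
  (ℤ.+-identityʳ (a 0 ℤ.* b (suc n)))

dilate-1 : ∀ a → dilate 1ℤ a ≗ a
dilate-1 a n = trans (cong (ℤ._* a n) (ℤ.^-zeroˡ n)) (ℤ.*-identityˡ (a n))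

linear-⊛-zero : ∀ p q a → (dilate 1ℤ (linear p q) ⊛ a) 0 ≡ p ℤ.* a 0
linear-⊛-zero p q a = trans (⊛-cong {b = a} (dilate-1 (linear p q)) (λ _ → refl) 0) (ℤ.+-identityʳ (p ℤ.* a 0))

linear-⊛-suc : ∀ p q a n → (dilate 1ℤ (linear p q) ⊛ a) (suc n) ≡ p ℤ.* a (suc n) ℤ.+ q ℤ.* a n
linear-⊛-suc p q a n = trans (⊛-cong {b = a} (dilate-1 (linear p q)) (λ _ → refl) (suc n))
  (cong (λ t → p ℤ.* a (suc n) ℤ.+ t) (constant-⊛ {linear p q ∘ suc} q refl (λ _ → refl) a n))

power : PowerSeries → ℕ → PowerSeries
power a zero    = one
power a (suc j) = a ⊛ power a j

one-suc : ∀ i → one (suc i) ≡ 0ℤ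
one-suc zero    = refl
one-suc (suc i) = refl

⊛-one : ∀ a → a ⊛ one ≗ a
⊛-one a zero    = trans (ℤ.+-identityʳ _) (ℤ.*-identityʳ (a 0))
⊛-one a (suc n) = trans
  (cong₂ ℤ._+_ (trans (cong (a 0 ℤ.*_) (one-suc n)) (ℤ.*-zeroʳ (a 0))) (⊛-one (a ∘ suc) n))
  (ℤ.+-identityˡ (a (suc n)))

-- `∏≤` nests to the left and `power` to the right. Associativity moves one factor at a time across,
-- and the exponent `j` accumulates the factors already moved.
∏≤-⊛-power : ∀ k {F a} → (∀ j → F j ≗ a) → ∀ j → ∏≤ k F ⊛ power a j ≗ power a (suc (k + j))
∏≤-⊛-power zero    {F} {a} F≗ j = ⊛-cong {b = power a j} (F≗ 0) (λ _ → refl)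
∏≤-⊛-power (suc k) {F} {a} F≗ j n = begin
  ((∏≤ k F ⊛ F (suc k)) ⊛ power a j) n
    ≡⟨ ⊛-assoc (∏≤ k F) (F (suc k)) (power a j) n ⟩
  (∏≤ k F ⊛ (F (suc k) ⊛ power a j)) n
    ≡⟨ ⊛-cong {∏≤ k F} (λ _ → refl) (⊛-cong {b = power a j} (F≗ (suc k)) (λ _ → refl)) n ⟩
  (∏≤ k F ⊛ power a (suc j)) n
    ≡⟨ ∏≤-⊛-power k F≗ (suc j) n ⟩
  power a (suc (k + suc j)) n
    ≡⟨ cong (λ i → power a (suc i) n) (ℕ.+-suc k j) ⟩
  power a (suc (suc (k + j))) n ∎
  where open ≡-Reasoning

-- The functional equation at s = 1.

module _ (k m′ c : ℕ) (ν : PowerSeries)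
  (ν-equation : dilate 1ℤ (linear 1ℤ (+ m′)) ⊛ ν
    ≗ one ⊖ dilate 1ℤ (linear 0ℤ (+ c)) ⊛ ∏≤ k (λ j → dilate (1ℤ ℤ.^ j) ν))
  where

  private
    P : PowerSeries
    P = ∏≤ k (λ j → dilate (1ℤ ℤ.^ j) ν)

  factor≗ν : ∀ j → dilate (1ℤ ℤ.^ j) ν ≗ ν
  factor≗ν j n = trans (cong (λ s → dilate s ν n) (ℤ.^-zeroˡ j)) (dilate-1 ν n)

  ν-zero : ν 0 ≡ 1ℤ
  ν-zero = begin
    ν 0                       ≡⟨ ℤ.*-identityˡ (ν 0) ⟨
    1ℤ ℤ.* ν 0                ≡⟨ linear-⊛-zero 1ℤ (+ m′) ν ⟨
    _                         ≡⟨ ν-equation 0 ⟩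
    1ℤ ℤ.- (dilate 1ℤ (linear 0ℤ (+ c)) ⊛ P) 0 ≡⟨ cong (ℤ._-_ 1ℤ) (linear-⊛-zero 0ℤ (+ c) P) ⟩
    1ℤ ℤ.- 0ℤ ℤ.* P 0         ≡⟨⟩
    1ℤ ∎
    where open ≡-Reasoning

  ν-suc : ∀ n → ν (suc n) ≡ ℤ.- (+ m′) ℤ.* ν n ℤ.+ ℤ.- (+ c) ℤ.* P n
  ν-suc n = solveFor (ν (suc n)) (+ m′) (ν n) (P (suc n)) (+ c) (P n) (begin
    1ℤ ℤ.* ν (suc n) ℤ.+ + m′ ℤ.* ν n     ≡⟨ linear-⊛-suc 1ℤ (+ m′) ν n ⟨
    _                                    ≡⟨ ν-equation (suc n) ⟩
    one (suc n) ℤ.- (dilate 1ℤ (linear 0ℤ (+ c)) ⊛ P) (suc n)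
      ≡⟨ cong₂ ℤ._-_ (one-suc n) (linear-⊛-suc 0ℤ (+ c) P n) ⟩
    0ℤ ℤ.- (0ℤ ℤ.* P (suc n) ℤ.+ + c ℤ.* P n) ∎)
    where
    open ≡-Reasoning
    solveFor : ∀ x p y z q w → 1ℤ ℤ.* x ℤ.+ p ℤ.* y ≡ 0ℤ ℤ.- (0ℤ ℤ.* z ℤ.+ q ℤ.* w) →
      x ≡ ℤ.- p ℤ.* y ℤ.+ ℤ.- q ℤ.* w
    solveFor x p y z q w eq = trans (isolate x p y)
      (trans (cong (ℤ._- p ℤ.* y) eq) (tidy p y z q w))
      where
      isolate : ∀ x p y → x ≡ (1ℤ ℤ.* x ℤ.+ p ℤ.* y) ℤ.- p ℤ.* y
      isolate = ℤ-Solver.solve-∀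
      tidy : ∀ p y z q w → 0ℤ ℤ.- (0ℤ ℤ.* z ℤ.+ q ℤ.* w) ℤ.- p ℤ.* y ≡ ℤ.- p ℤ.* y ℤ.+ ℤ.- q ℤ.* w
      tidy = ℤ-Solver.solve-∀

  -- The first of the `suc j` factors is split into its constant term 1, which leaves the power `j`,
  -- and its shift, which `ν-suc` replaces by a combination of `ν` and `P`. As `P` is a product of
  -- `k + 1` copies of `ν`, it raises the exponent to `suc (k + j)`.
  power-ν-suc : ∀ j n → power ν (suc j) (suc n)
    ≡ power ν j (suc n) ℤ.+ (ℤ.- (+ m′) ℤ.* power ν (suc j) n ℤ.+ ℤ.- (+ c) ℤ.* power ν (suc (k + j)) n)
  power-ν-suc j n = cong₂ ℤ._+_
    (trans (cong (ℤ._* power ν j (suc n)) ν-zero) (ℤ.*-identityˡ (power ν j (suc n))))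
    (begin
      ((ν ∘ suc) ⊛ power ν j) n
        ≡⟨ ⊛-cong {b = power ν j} ν-suc (λ _ → refl) n ⟩
      ((λ i → ℤ.- (+ m′) ℤ.* ν i ℤ.+ ℤ.- (+ c) ℤ.* P i) ⊛ power ν j) n
        ≡⟨ ⊛-linearˡ (ℤ.- (+ m′)) (ℤ.- (+ c)) ν P (power ν j) n ⟩
      ℤ.- (+ m′) ℤ.* power ν (suc j) n ℤ.+ ℤ.- (+ c) ℤ.* (P ⊛ power ν j) n
        ≡⟨ cong (λ t → ℤ.- (+ m′) ℤ.* power ν (suc j) n ℤ.+ ℤ.- (+ c) ℤ.* t) (∏≤-⊛-power k factor≗ν j n) ⟩
      ℤ.- (+ m′) ℤ.* power ν (suc j) n ℤ.+ ℤ.- (+ c) ℤ.* power ν (suc (k + j)) n ∎)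
    where open ≡-Reasoning

  -- `power-ν-suc` is the recursion of `coeff` with the signs of `m′` and `c` reversed. Each of
  -- these factors comes with one power of r, so the substitution of -x for r absorbs all signs.
  power-ν : ∀ j n → power ν j n ≡ dilate -1ℤ (λ i → + coeff k m′ c j i) n
  power-ν zero    zero          = refl
  power-ν zero    (suc zero)    = refl
  power-ν zero    (suc (suc n)) = sym (ℤ.*-zeroʳ (-1ℤ ℤ.^ suc (suc n)))
  power-ν (suc j) zero    = trans (ℤ.+-identityʳ _)
    (trans (cong₂ ℤ._*_ ν-zero (power-ν j 0)) (ℤ.*-identityˡ _))
  power-ν (suc j) (suc n) = begin
    power ν (suc j) (suc n)
      ≡⟨ power-ν-suc j n ⟩
    power ν j (suc n) ℤ.+ (ℤ.- (+ m′) ℤ.* power ν (suc j) n ℤ.+ ℤ.- (+ c) ℤ.* power ν (suc (k + j)) n)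
      ≡⟨ cong₂ ℤ._+_ (power-ν j (suc n))
           (cong₂ (λ v w → ℤ.- (+ m′) ℤ.* v ℤ.+ ℤ.- (+ c) ℤ.* w) (power-ν (suc j) n) (power-ν (suc (k + j)) n)) ⟩
    -1ℤ ℤ.* s ℤ.* (+ x) ℤ.+ (ℤ.- (+ m′) ℤ.* (s ℤ.* (+ y)) ℤ.+ ℤ.- (+ c) ℤ.* (s ℤ.* (+ z)))
      ≡⟨ factorSign s (+ x) (+ m′) (+ y) (+ c) (+ z) ⟩
    -1ℤ ℤ.* s ℤ.* ((+ x) ℤ.+ ((+ m′) ℤ.* (+ y) ℤ.+ (+ c) ℤ.* (+ z)))
      ≡⟨ cong (λ t → -1ℤ ℤ.* s ℤ.* ((+ x) ℤ.+ t)) (cong₂ ℤ._+_ (ℤ.pos-* m′ y) (ℤ.pos-* c z)) ⟨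
    -1ℤ ℤ.* s ℤ.* (+ (x + (m′ * y + c * z))) ∎
    where
    open ≡-Reasoning
    s = -1ℤ ℤ.^ n
    x = coeff k m′ c j (suc n)
    y = coeff k m′ c (suc j) n
    z = coeff k m′ c (suc (k + j)) n
    factorSign : ∀ s x p y q z →
      -1ℤ ℤ.* s ℤ.* x ℤ.+ (ℤ.- p ℤ.* (s ℤ.* y) ℤ.+ ℤ.- q ℤ.* (s ℤ.* z))
      ≡ -1ℤ ℤ.* s ℤ.* (x ℤ.+ (p ℤ.* y ℤ.+ q ℤ.* z))
    factorSign = ℤ-Solver.solve-∀

  -- Both `b` and `coeff` at exponent 1 yield `ν` after dilation by -1, and the sign cancels because
  -- it is nonzero.
  expansion : ∀ (b : PowerSeries) → ν ≗ dilate -1ℤ b → ∀ n → b n ≡ + coeff k m′ c 1 n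
  expansion b ν≗ n = ℤ.*-cancelˡ-≡ (-1ℤ ℤ.^ n) _ _ {{ℤ.≢-nonZero λ eq → -1≢0 (ℤ.i^n≡0⇒i≡0 -1ℤ n eq)}} (begin
    -1ℤ ℤ.^ n ℤ.* b n    ≡⟨ ν≗ n ⟨
    ν n                  ≡⟨ ⊛-one ν n ⟨
    power ν 1 n          ≡⟨ power-ν 1 n ⟩
    -1ℤ ℤ.^ n ℤ.* + coeff k m′ c 1 n ∎)
    where
    open ≡-Reasoning
    -1≢0 : -1ℤ ≢ 0ℤ
    -1≢0 ()

-- Binomial identities and the Fuss-Catalan formula.

-- The absorption identity (n + 1) C(N , n + 1) = (N - n) C(N , n), kept free of truncated
-- subtraction; the induction is by Pascal's rule.
C-absorption : ∀ N n → suc n * (N C suc n) + n * (N C n) ≡ N * (N C n)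
C-absorption zero    zero    = refl
C-absorption zero    (suc n)
  rewrite k>n⇒nCk≡0 {0} {suc n} z<s | k>n⇒nCk≡0 {0} {suc (suc n)} z<s =
  cong₂ _+_ (ℕ.*-zeroʳ (suc (suc n))) (ℕ.*-zeroʳ (suc n))
C-absorption (suc N) zero    = trans (ℕ.+-identityʳ _)
  (trans (ℕ.*-identityˡ _) (trans (nC1≡n (suc N)) (sym (ℕ.*-identityʳ (suc N)))))
C-absorption (suc N) (suc n) = begin
  suc (suc n) * (suc N C suc (suc n)) + suc n * (suc N C suc n)
    ≡⟨ cong₂ (λ s t → suc (suc n) * s + suc n * t)
         (nCk+nC[k+1]≡[n+1]C[k+1] N (suc n)) (nCk+nC[k+1]≡[n+1]C[k+1] N n) ⟨
  suc (suc n) * (b + d) + suc n * (a + b)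
    ≡⟨ separate n a b d ⟩
  (suc n * b + n * a) + (suc (suc n) * d + suc n * b) + (a + b)
    ≡⟨ cong (_+ (a + b)) (cong₂ _+_ (C-absorption N n) (C-absorption N (suc n))) ⟩
  N * a + N * b + (a + b)
    ≡⟨ collect N a b ⟩
  suc N * (a + b)
    ≡⟨ cong (suc N *_) (nCk+nC[k+1]≡[n+1]C[k+1] N n) ⟩
  suc N * (suc N C suc n) ∎
  where
  open ≡-Reasoning
  a = N C n
  b = N C suc n
  d = N C suc (suc n)
  separate : ∀ n a b d → suc (suc n) * (b + d) + suc n * (a + b)
    ≡ (suc n * b + n * a) + (suc (suc n) * d + suc n * b) + (a + b)
  separate = solve-∀
  collect : ∀ N a b → N * a + N * b + (a + b) ≡ suc N * (a + b)
  collect = solve-∀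

coeff-zero : ∀ k m′ c j → coeff k m′ c j 0 ≡ 1
coeff-zero k m′ c zero    = refl
coeff-zero k m′ c (suc j) = coeff-zero k m′ c j

-- The ballot-type formula C(A , n + 1) - k C(A , n), with the subtrahend moved to the left:
-- in this form the recursion of coeff is Pascal's rule applied twice.
ballot : ∀ k j n → let A = j + (k + n * suc k) in
  coeff k 0 1 j (suc n) + k * (A C n) ≡ A C suc n
-- For exponent 0 the coefficient vanishes, and what remains is absorption with `A - n = suc n * k`;
-- the factor `suc n` is cancelled.
ballot k zero n = ℕ.*-cancelˡ-≡ _ _ (suc n) (ℕ.+-cancelʳ-≡ (n * (A C n)) _ _ (begin
  suc n * (k * (A C n)) + n * (A C n) ≡⟨ collect k n (A C n) ⟩
  A * (A C n)                         ≡⟨ C-absorption A n ⟨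
  suc n * (A C suc n) + n * (A C n)   ∎))
  where
  open ≡-Reasoning
  A = k + n * suc k
  collect : ∀ k n x → suc n * (k * x) + n * x ≡ (k + n * suc k) * x
  collect = solve-∀
ballot k (suc j) zero = begin
  x + (coeff k 0 1 (suc (k + j)) 0 + 0) + k * 1
    ≡⟨ cong (λ t → x + (t + 0) + k * 1) (coeff-zero k 0 1 (suc (k + j))) ⟩
  x + 1 + k * 1
    ≡⟨ move x (k * 1) ⟩
  suc (x + k * 1)
    ≡⟨ cong suc (trans (ballot k j 0) (nC1≡n A)) ⟩
  suc A
    ≡⟨ nC1≡n (suc A) ⟨
  suc A C 1 ∎
  where
  open ≡-Reasoning
  A = j + (k + 0)
  x = coeff k 0 1 j 1
  move : ∀ x y → x + 1 + y ≡ suc (x + y)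
  move = solve-∀
ballot k (suc j) (suc n) = begin
  x + (y + 0) + k * (suc A C suc n)
    ≡⟨ cong (λ t → x + (y + 0) + k * t) (nCk+nC[k+1]≡[n+1]C[k+1] A n) ⟨
  x + (y + 0) + k * ((A C n) + (A C suc n))
    ≡⟨ regroup x y k (A C n) (A C suc n) ⟩
  y + k * (A C n) + (x + k * (A C suc n))
    ≡⟨ cong₂ _+_ IHy (ballot k j (suc n)) ⟩
  (A C suc n) + (A C suc (suc n))
    ≡⟨ nCk+nC[k+1]≡[n+1]C[k+1] A (suc n) ⟩
  suc A C suc (suc n) ∎
  where
  open ≡-Reasoning
  A = j + (k + suc n * suc k)
  x = coeff k 0 1 j (suc (suc n))
  y = coeff k 0 1 (suc (k + j)) (suc n)
  -- Both induction hypotheses, at `(k + j + 1 , n)` and at `(j , n + 1)`, have the same upper index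
  -- `A`, so their right sides add up by Pascal's rule.
  same : ∀ k j n → suc (k + j) + (k + n * suc k) ≡ j + (k + suc n * suc k)
  same = solve-∀
  IHy : y + k * (A C n) ≡ A C suc n
  IHy = subst (λ B → y + k * (B C n) ≡ B C suc n) (same k j n) (ballot k (suc (k + j)) n)
  regroup : ∀ x y k p q → x + (y + 0) + k * (p + q) ≡ y + k * p + (x + k * q)
  regroup = solve-∀

-- By `ballot` at exponent 1 the coefficient is C(A , n + 1) - k C(A , n) with `A = suc k * suc n`.
-- Here A - n = k (n + 1) + 1, so absorption evaluates this difference after multiplication by
-- `suc (k * suc n)`.
coeff-fussCatalan : ∀ k n → suc (k * n) * coeff k 0 1 1 n ≡ (suc k * n) C n
coeff-fussCatalan k zero    rewrite ℕ.*-zeroʳ k = refl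
-- The term added on both sides is `k` times the left side of `C-absorption`, which keeps the
-- computation in ℕ.
coeff-fussCatalan k (suc n) = ℕ.+-cancelʳ-≡ (k * (suc n * (A C suc n) + n * (A C n))) _ _ (begin
  suc (k * suc n) * x + k * (suc n * (A C suc n) + n * (A C n))
    ≡⟨ cong (λ t → suc (k * suc n) * x + k * t) (C-absorption A n) ⟩
  suc (k * suc n) * x + k * (A * (A C n))
    ≡⟨ separate k n x (A C n) ⟩
  suc (k * suc n) * (x + k * (A C n)) + k * n * (A C n)
    ≡⟨ cong (λ t → suc (k * suc n) * t + k * n * (A C n)) bal ⟩
  suc (k * suc n) * (A C suc n) + k * n * (A C n)
    ≡⟨ collect k n (A C n) (A C suc n) ⟩
  (A C suc n) + k * (suc n * (A C suc n) + n * (A C n)) ∎)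
  where
  open ≡-Reasoning
  A = suc k * suc n
  x = coeff k 0 1 1 (suc n)
  same : ∀ k n → 1 + (k + n * suc k) ≡ suc k * suc n
  same = solve-∀
  bal : x + k * (A C n) ≡ A C suc n
  bal = subst (λ B → x + k * (B C n) ≡ B C suc n) (same k n) (ballot k 1 n)
  separate : ∀ k n x a → suc (k * suc n) * x + k * (suc k * suc n * a)
    ≡ suc (k * suc n) * (x + k * a) + k * n * a
  separate = solve-∀
  collect : ∀ k n a b → suc (k * suc n) * b + k * n * a ≡ b + k * (suc n * b + n * a)
  collect = solve-∀

-- Equality is tested on unnormalised fractions, where it is cross-multiplication and no common
-- divisors have to be removed.
≡-fussCatalan : ∀ k n d → suc (k * n) * d ≡ (suc k * n) C n → (+ d) / 1 ≡ fussCatalan k n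
≡-fussCatalan k n d eq = ℚ.toℚᵘ-injective (begin
  ℚ.toℚᵘ ((+ d) / 1)
    ≈⟨ ℚ.toℚᵘ-fromℚᵘ (mkℚᵘ (+ d) 0) ⟩
  mkℚᵘ (+ d) 0
    ≈⟨ *≡* cross ⟩
  mkℚᵘ (+ 1) (k * n) ℚᵘ.* mkℚᵘ (+ c) 0
    ≈⟨ ℚᵘ.*-cong (ℚ.toℚᵘ-fromℚᵘ (mkℚᵘ (+ 1) (k * n))) (ℚ.toℚᵘ-fromℚᵘ (mkℚᵘ (+ c) 0)) ⟨
  ℚ.toℚᵘ ((+ 1) / suc (k * n)) ℚᵘ.* ℚ.toℚᵘ ((+ c) / 1)
    ≈⟨ ℚ.toℚᵘ-homo-* ((+ 1) / suc (k * n)) ((+ c) / 1) ⟨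
  ℚ.toℚᵘ (fussCatalan k n) ∎)
  where
  open ℚᵘ.≃-Reasoning
  c = (suc k * n) C n
  cross : (+ d) ℤ.* + (suc (k * n) * 1) ≡ ((+ 1) ℤ.* (+ c)) ℤ.* (+ 1)
  cross = trans (sym (ℤ.pos-* d (suc (k * n) * 1)))
    (trans (cong +_ (trans (cong (d *_) (ℕ.*-identityʳ (suc (k * n)))) (trans (ℕ.*-comm d (suc (k * n))) eq)))
    (sym (trans (ℤ.*-identityʳ ((+ 1) ℤ.* (+ c))) (ℤ.*-identityˡ (+ c)))))

-- Sums over lists and lists without repetition.

module _ {A : Set} where

  total : (A → ℕ) → List A → ℕ
  total φ xs = sum (map φ xs)

  total-++ : ∀ φ xs ys → total φ (xs ++ ys) ≡ total φ xs + total φ ys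
  total-++ φ xs ys = trans (cong sum (map-++ φ xs ys)) (sum-++ (map φ xs) (map φ ys))

  total-map : ∀ {B : Set} (φ : A → ℕ) (h : B → A) xs → total φ (map h xs) ≡ sum (map (φ ∘ h) xs)
  total-map φ h xs = cong sum (sym (map-∘ xs))

  total-zero : ∀ xs → total (λ _ → 0) xs ≡ 0
  total-zero []       = refl
  total-zero (_ ∷ xs) = total-zero xs

  total-linear : ∀ a (φ ψ : A → ℕ) xs → total (λ x → a * φ x + ψ x) xs ≡ a * total φ xs + total ψ xs
  total-linear a φ ψ []       = sym (trans (ℕ.+-identityʳ _) (ℕ.*-zeroʳ a))
  total-linear a φ ψ (x ∷ xs) = trans (cong (λ t → a * φ x + ψ x + t) (total-linear a φ ψ xs))
    (regroup a (φ x) (ψ x) (total φ xs) (total ψ xs))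
    where
    regroup : ∀ a p q r s → a * p + q + (a * r + s) ≡ a * (p + r) + (q + s)
    regroup = solve-∀

  sumℕ-lookup : ∀ (φ : A → ℕ) xs → sumℕ (φ ∘ lookup xs) ≡ total φ xs
  sumℕ-lookup φ []       = refl
  sumℕ-lookup φ (x ∷ xs) = cong (λ t → φ x + t) (sumℕ-lookup φ xs)

  length-concatMap : ∀ {B : Set} (h : B → List A) xs → length (concatMap h xs) ≡ sum (map (length ∘ h) xs)
  length-concatMap h []       = refl
  length-concatMap h (x ∷ xs) = trans (length-++ (h x)) (cong (λ t → length (h x) + t) (length-concatMap h xs))

  unique⇒lookup-injective : ∀ {xs : List A} → Unique xs → ∀ i j → lookup xs i ≡ lookup xs j → i ≡ j
  unique⇒lookup-injective (_   ∷ _)  zero    zero    _  = refl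
  unique⇒lookup-injective (x∉  ∷ _)  zero    (suc j) eq = contradiction eq (All.lookup x∉ (∈-lookup j))
  unique⇒lookup-injective (x∉  ∷ _)  (suc i) zero    eq = contradiction (sym eq) (All.lookup x∉ (∈-lookup i))
  unique⇒lookup-injective (_   ∷ xs!) (suc i) (suc j) eq = cong suc (unique⇒lookup-injective xs! i j eq)

-- Enumeration of lattice words by height.

module Words {Step : Set} (δ : Step → Point) (k : ℕ)
  (fall : Step) (rises : List Step) (gain : Step → ℕ)
  (δ-fall : δ fall ≡ (1 , 0))
  -- The height is `k y - x`, so a step `(a , 1)` raises it by `k - a`; this is `gain s`.
  (δ-rise : ∀ {s} → s ∈ rises → proj₁ (δ s) + gain s ≡ k × proj₂ (δ s) ≡ 1)
  (steps! : Unique (fall ∷ rises)) (step∈ : ∀ s → s ∈ fall ∷ rises)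
  where

  -- words h n lists the words with n rises that lead from height h = k y - x down to
  -- height 0 without becoming negative, separated by their first step.
  words fallFirst riseFirst : ℕ → ℕ → List (List Step)
  words h n = fallFirst h n ++ riseFirst h n
  -- The empty word is placed here, so that `fallFirst h` corresponds to exponent `h` of `coeff` and
  -- `words h` to exponent `suc h`.
  fallFirst zero    zero    = [] ∷ []
  fallFirst zero    (suc n) = []
  fallFirst (suc h) n       = map (fall ∷_) (words h n)
  riseFirst h zero    = []
  riseFirst h (suc n) = concatMap (λ s → map (s ∷_) (words (gain s + h) n)) rises

  ∈-fallFirst⁻ : ∀ h n {s w} → s ∷ w ∈ fallFirst h n → s ≡ fall
  ∈-fallFirst⁻ zero    zero    (here ())
  ∈-fallFirst⁻ zero    zero    (there ())
  ∈-fallFirst⁻ (suc h) n w∈ with ∈-map⁻ (fall ∷_) w∈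
  ... | _ , _ , refl = refl

  ∈-riseFirst⁻ : ∀ h n {w} → w ∈ riseFirst h n →
    ∃[ n′ ] ∃[ s ] ∃[ v ] n ≡ suc n′ × s ∈ rises × v ∈ words (gain s + h) n′ × w ≡ s ∷ v
  ∈-riseFirst⁻ h (suc n) w∈ with find (∈-concatMap⁻ (λ s → map (s ∷_) (words (gain s + h) n)) {rises} w∈)
  ... | s , s∈ , sw∈ with ∈-map⁻ (s ∷_) sw∈
  ... | v , v∈ , refl = n , s , v , refl , s∈ , v∈ , refl

  words! : ∀ h n → Unique (words h n)
  fallFirst! : ∀ h n → Unique (fallFirst h n)
  riseFirst! : ∀ h n → Unique (riseFirst h n)
  words! h n = Unique.++⁺ (fallFirst! h n) (riseFirst! h n) disjoint
    where
    disjoint : Disjoint (fallFirst h n) (riseFirst h n)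
    disjoint (∈₁ , ∈₂) with ∈-riseFirst⁻ h n ∈₂
    ... | _ , s , v , _ , s∈ , _ , refl =
      contradiction (sym (∈-fallFirst⁻ h n ∈₁)) (All.lookup (AllPairs.head steps!) s∈)
  fallFirst! zero    zero    = [] ∷ []
  fallFirst! zero    (suc n) = []
  fallFirst! (suc h) n       = Unique.map⁺ ∷-injectiveʳ (words! h n)
  riseFirst! h zero    = []
  riseFirst! h (suc n) = Unique.concat⁺
    (All.map⁺ (All.tabulate λ {s} _ → Unique.map⁺ ∷-injectiveʳ (words! (gain s + h) n)))
    (AllPairs.map⁺ (AllPairs.map disjoint (AllPairs.tail steps!)))
    where
    disjoint : ∀ {s t} → s ≢ t →
      Disjoint (map (s ∷_) (words (gain s + h) n)) (map (t ∷_) (words (gain t + h) n))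
    disjoint {s} {t} s≢t (∈₁ , ∈₂) with ∈-map⁻ (s ∷_) ∈₁ | ∈-map⁻ (t ∷_) ∈₂
    ... | _ , _ , refl | _ , _ , refl = s≢t refl

  -- Since `h` is a natural number, this form without subtraction also implies that the point is not
  -- below the line.
  AtHeight : ℕ → Point → Set
  AtHeight h (x , y) = x + h ≡ k * y

  fall-height : ∀ {h} p → AtHeight (suc h) p → AtHeight h (p ⊕ δ fall)
  fall-height {h} (x , y) eq rewrite δ-fall = begin
    x + 1 + h   ≡⟨ ℕ.+-assoc x 1 h ⟩
    x + suc h   ≡⟨ eq ⟩
    k * y       ≡⟨ cong (k *_) (ℕ.+-identityʳ y) ⟨
    k * (y + 0) ∎
    where open ≡-Reasoning

  rise-height : ∀ {h s} p → s ∈ rises → AtHeight h p → AtHeight (gain s + h) (p ⊕ δ s)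
  rise-height {h} {s} (x , y) s∈ eq with δ s | δ-rise s∈
  ... | (a , .1) | refl , refl = begin
    x + a + (gain s + h)  ≡⟨ regroup x a (gain s) h ⟩
    x + h + (a + gain s)  ≡⟨ cong (_+ (a + gain s)) eq ⟩
    (a + gain s) * y + (a + gain s) ≡⟨ distrib (a + gain s) y ⟩
    (a + gain s) * (y + 1) ∎
    where
    open ≡-Reasoning
    regroup : ∀ x a r h → x + a + (r + h) ≡ x + h + (a + r)
    regroup = solve-∀
    distrib : ∀ k y → k * y + k ≡ k * (y + 1)
    distrib = solve-∀

  fall-size : ∀ n p → n + proj₂ (p ⊕ δ fall) ≡ n + proj₂ p
  fall-size n p = cong (λ t → n + t) (trans (cong (λ q → proj₂ p + proj₂ q) δ-fall) (ℕ.+-identityʳ _))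

  rise-size : ∀ n p {s} → s ∈ rises → n + proj₂ (p ⊕ δ s) ≡ suc n + proj₂ p
  rise-size n p s∈ = trans (cong (λ b → n + (proj₂ p + b)) (proj₂ (δ-rise s∈))) (move n (proj₂ p))
    where
    move : ∀ n y → n + (y + 1) ≡ suc n + y
    move = solve-∀

  LeadsTo : Point → ℕ → List Step → Set
  LeadsTo p N w = endpoint δ p w ≡ (k * N , N) × All (NotBelow k) (vertices δ p w)

  notBelow : ∀ {h} p → AtHeight h p → NotBelow k p
  notBelow (x , y) eq = ℕ.≤-trans (ℕ.m≤m+n x _) (ℕ.≤-reflexive eq)

  fall-below : ∀ p → AtHeight 0 p → ¬ NotBelow k (p ⊕ δ fall)
  fall-below (x , y) eq above rewrite δ-fall = ℕ.<-irrefl refl (begin-strict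
    x           <⟨ ℕ.m<m+n x z<s ⟩
    x + 1       ≤⟨ above ⟩
    k * (y + 0) ≡⟨ cong (k *_) (ℕ.+-identityʳ y) ⟩
    k * y       ≡⟨ eq ⟨
    x + 0       ≡⟨ ℕ.+-identityʳ x ⟩
    x           ∎)
    where open ℕ.≤-Reasoning

  first-notBelow : ∀ {p} w → All (NotBelow k) (vertices δ p w) → NotBelow k p
  first-notBelow []      (above ∷ _) = above
  first-notBelow (_ ∷ _) (above ∷ _) = above

  -- With `n` rises still to come, the final ordinate is `n + proj₂ p`; arriving at height 0 then
  -- fixes the abscissa.
  words-sound : ∀ h n {w} p → AtHeight h p → w ∈ words h n → LeadsTo p (n + proj₂ p) w
  fallFirst-sound : ∀ h n {w} p → AtHeight h p → w ∈ fallFirst h n → LeadsTo p (n + proj₂ p) w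
  riseFirst-sound : ∀ h n {w} p → AtHeight h p → w ∈ riseFirst h n → LeadsTo p (n + proj₂ p) w
  words-sound h n p eq w∈ with ∈-++⁻ (fallFirst h n) w∈
  ... | inj₁ ∈₁ = fallFirst-sound h n p eq ∈₁
  ... | inj₂ ∈₂ = riseFirst-sound h n p eq ∈₂
  fallFirst-sound zero zero p eq (here refl) =
    cong (_, proj₂ p) (trans (sym (ℕ.+-identityʳ (proj₁ p))) eq) , notBelow p eq ∷ []
  fallFirst-sound (suc h) n p eq w∈ with ∈-map⁻ (fall ∷_) w∈
  ... | v , v∈ , refl with words-sound h n (p ⊕ δ fall) (fall-height p eq) v∈
  ... | end , above = subst (λ N → endpoint δ (p ⊕ δ fall) v ≡ (k * N , N)) (fall-size n p) end , notBelow p eq ∷ above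
  riseFirst-sound h (suc n) p eq w∈ with ∈-riseFirst⁻ h (suc n) w∈
  ... | _ , s , v , refl , s∈ , v∈ , refl
    with words-sound (gain s + h) n (p ⊕ δ s) (rise-height p s∈ eq) v∈
  ... | end , above = subst (λ N → endpoint δ (p ⊕ δ s) v ≡ (k * N , N)) (rise-size n p s∈) end , notBelow p eq ∷ above

  -- Induction on the word. Its number of rises is not given in advance and is returned as the
  -- witness `n`.
  words-complete : ∀ w h p N → AtHeight h p → LeadsTo p N w →
    ∃[ n ] N ≡ n + proj₂ p × w ∈ words h n
  -- A word that ends at once does so at `(k * N , N)`, which forces `h` to be 0.
  words-complete [] h p N eq (refl , _) = 0 , refl , nil∈ h (ℕ.+-cancelˡ-≡ (k * N) h 0 (trans eq (sym (ℕ.+-identityʳ (k * N)))))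
    where
    nil∈ : ∀ h → h ≡ 0 → [] ∈ words h 0
    nil∈ .0 refl = here refl
  words-complete (s ∷ w) h p N eq (end , _ ∷ above) with step∈ s
  -- A fall from height 0 would end below the line.
  words-complete (s ∷ w) zero p N eq (end , _ ∷ above) | here refl =
    contradiction (first-notBelow w above) (fall-below p eq)
  words-complete (s ∷ w) (suc h) p N eq (end , _ ∷ above) | here refl
    with words-complete w h (p ⊕ δ fall) N (fall-height p eq) (end , above)
  ... | n , N≡ , w∈ = n , trans N≡ (fall-size n p) , ∈-++⁺ˡ (∈-map⁺ (fall ∷_) w∈)
  words-complete (s ∷ w) h p N eq (end , _ ∷ above) | there s∈
    with words-complete w (gain s + h) (p ⊕ δ s) N (rise-height p s∈ eq) (end , above)
  ... | n , N≡ , w∈ = suc n , trans N≡ (rise-size n p s∈) ,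
    ∈-++⁺ʳ (fallFirst h (suc n)) (∈-concatMap⁺ _ (lose s∈ (∈-map⁺ (s ∷_) w∈)))

  -- An index is sent to the word at that position, and a path to the position of its word. The
  -- absence of repetitions makes the position unique.
  paths : ∀ n → Fin (length (words 0 n)) ↔ Path δ k n
  paths n = mk↔ₛ′ to from to-from from-to
    where
    origin : AtHeight 0 (0 , 0)
    origin = sym (ℕ.*-zeroʳ k)

    leads : ∀ i → LeadsTo (0 , 0) n (lookup (words 0 n) i)
    leads i = subst (λ N → LeadsTo (0 , 0) N (lookup (words 0 n) i)) (ℕ.+-identityʳ n)
      (words-sound 0 n (0 , 0) origin (∈-lookup i))

    to : Fin (length (words 0 n)) → Path δ k n
    to i = mkPath (lookup (words 0 n) i) (proj₁ (leads i)) (proj₂ (leads i))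

    steps∈ : (μ : Path δ k n) → Path.steps μ ∈ words 0 n
    steps∈ (mkPath w e a)
      with words-complete w 0 (0 , 0) n origin
             -- The two path conditions are irrelevant fields; as they are decidable, usable proofs
             -- can be recovered.
             ( recompute (≡-dec ℕ._≟_ ℕ._≟_ _ _) e
             , recompute (all? (λ q → proj₁ q ℕ.≤? k * proj₂ q) _) a)
    ... | n′ , n≡ , w∈ = subst (λ N → w ∈ words 0 N) (sym (trans n≡ (ℕ.+-identityʳ n′))) w∈

    from : Path δ k n → Fin (length (words 0 n))
    from μ = index (steps∈ μ)

    Path-≡ : {μ μ′ : Path δ k n} → Path.steps μ ≡ Path.steps μ′ → μ ≡ μ′
    Path-≡ {mkPath _ _ _} {mkPath _ _ _} refl = refl

    to-from : ∀ μ → to (from μ) ≡ μ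
    to-from μ = Path-≡ (sym (lookup-index (steps∈ μ)))

    from-to : ∀ i → from (to i) ≡ i
    from-to i = unique⇒lookup-injective (words! 0 n) _ _ (sym (lookup-index (steps∈ (to i))))

  module _ {m′ c : ℕ}
    -- Tested against every `φ`, this says that `m′` rises keep the height and `c` rises add `k` to
    -- it.
    (rises-gain : ∀ φ → total (φ ∘ gain) rises ≡ m′ * φ 0 + c * φ k)
    where

    -- The lists split by first step exactly as `coeff` unfolds: `fallFirst` gives its first summand
    -- and `riseFirst` the other two.
    length-words : ∀ h n → length (words h n) ≡ coeff k m′ c (suc h) n
    length-fallFirst : ∀ h n → length (fallFirst h n) ≡ coeff k m′ c h n
    length-words h zero = trans (length-++ (fallFirst h zero))
      (trans (ℕ.+-identityʳ _) (length-fallFirst h zero))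
    length-words h (suc n) = trans (length-++ (fallFirst h (suc n)))
      (cong₂ _+_ (length-fallFirst h (suc n)) (begin
        length (riseFirst h (suc n))
          ≡⟨ length-concatMap _ rises ⟩
        sum (map (λ s → length (map (s ∷_) (words (gain s + h) n))) rises)
          ≡⟨ cong sum (map-cong (λ s → trans (length-map _ (words (gain s + h) n)) (length-words (gain s + h) n)) rises) ⟩
        total ((λ r → coeff k m′ c (suc (r + h)) n) ∘ gain) rises
          ≡⟨ rises-gain (λ r → coeff k m′ c (suc (r + h)) n) ⟩
        m′ * coeff k m′ c (suc h) n + c * coeff k m′ c (suc (k + h)) n ∎))
      where open ≡-Reasoning
    length-fallFirst zero    zero    = refl
    length-fallFirst zero    (suc n) = refl
    length-fallFirst (suc h) n       = trans (length-map _ (words h n)) (length-words h n)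

    path-count : ∀ n → HasCardinality (Path δ k n) (coeff k m′ c 1 n)
    path-count n = subst (λ N → Fin N ↔ Path δ k n) (length-words 0 n) (paths n)

-- The Dyck, coloured and Schröder step sets.

module DyckWords (k : ℕ) where

  steps! : Unique {A = DyckStep} (D ∷ U ∷ [])
  steps! = ((λ ()) ∷ []) ∷ [] ∷ []

  step∈ : (s : DyckStep) → s ∈ D ∷ U ∷ []
  step∈ D = here refl
  step∈ U = there (here refl)

  δ-rise : ∀ {s} → s ∈ U ∷ [] → proj₁ (δDyck s) + k ≡ k × proj₂ (δDyck s) ≡ 1
  δ-rise (here refl) = refl , refl

  open Words δDyck k D (U ∷ []) (λ _ → k) refl δ-rise steps! step∈ public

module ColouredWords (k : ℕ) where

  steps! : Unique (D ∷ U zero ∷ U (suc zero) ∷ [])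
  steps! = ((λ ()) ∷ (λ ()) ∷ []) ∷ ((λ ()) ∷ []) ∷ [] ∷ []

  step∈ : ∀ s → s ∈ D ∷ U zero ∷ U (suc zero) ∷ []
  step∈ D              = here refl
  step∈ (U zero)       = there (here refl)
  step∈ (U (suc zero)) = there (there (here refl))

  δ-rise : ∀ {s} → s ∈ U zero ∷ U (suc zero) ∷ [] →
    proj₁ (δColoured s) + k ≡ k × proj₂ (δColoured s) ≡ 1
  δ-rise (here refl)         = refl , refl
  δ-rise (there (here refl)) = refl , refl

  open Words δColoured k D (U zero ∷ U (suc zero) ∷ []) (λ _ → k) refl δ-rise steps! step∈ public

module SchröderWords (k : ℕ) where

  gain : SchröderStep → ℕ
  gain U = k
  gain D = 0
  gain H = 0

  steps! : Unique {A = SchröderStep} (D ∷ H ∷ U ∷ [])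
  steps! = ((λ ()) ∷ (λ ()) ∷ []) ∷ ((λ ()) ∷ []) ∷ [] ∷ []

  step∈ : (s : SchröderStep) → s ∈ D ∷ H ∷ U ∷ []
  step∈ D = here refl
  step∈ H = there (here refl)
  step∈ U = there (there (here refl))

  δ-rise : ∀ {s} → s ∈ H ∷ U ∷ [] →
    proj₁ (δSchröder k s) + gain s ≡ k × proj₂ (δSchröder k s) ≡ 1
  δ-rise (here refl)         = ℕ.+-identityʳ k , refl
  δ-rise (there (here refl)) = refl , refl

  open Words (δSchröder k) k D (H ∷ U ∷ []) gain refl δ-rise steps! step∈ public

  rises-gain : ∀ φ → total (φ ∘ gain) (H ∷ U ∷ []) ≡ 1 * φ 0 + 1 * φ k
  rises-gain φ = cong (_+ (φ k + 0)) (sym (ℕ.+-identityʳ (φ 0)))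

-- Dyck words weighted by the pattern U Dᵏ.

module WeightedDyck (k : ℕ) where
  open DyckWords k

  -- At `i = k` this is the surplus from weight 4 over weight 3 for a preceding `U`. The prefix
  -- length `i` is separate from the `k` in the weight to permit induction on it.
  weightIfPrefix : ℕ → List DyckStep → ℕ
  weightIfPrefix i w = if does (prefix? _≟_ (replicate i D) w) then wordWeight k w else 0

  wordWeight-U : ∀ w → wordWeight k (U ∷ w) ≡ 3 * wordWeight k w + weightIfPrefix k w
  wordWeight-U w with does (prefix? _≟_ (replicate k D) w)
  ... | true  = ℕ.+-comm (wordWeight k w) (3 * wordWeight k w)
  ... | false = sym (ℕ.+-identityʳ (3 * wordWeight k w))

  -- Deleting the prefix Dⁱ is a weight-preserving bijection onto the words from height h.
  total-weightIfPrefix : ∀ i h n →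
    total (weightIfPrefix i) (words (i + h) n) ≡ total (wordWeight k) (words h n)
  total-weightIfPrefix zero    h n = refl
  total-weightIfPrefix (suc i) h n = begin
    total φ (map (D ∷_) (words (i + h) n) ++ riseFirst (suc (i + h)) n)
      ≡⟨ total-++ φ (map (D ∷_) (words (i + h) n)) _ ⟩
    total φ (map (D ∷_) (words (i + h) n)) + total φ (riseFirst (suc (i + h)) n)
      ≡⟨ cong₂ _+_ (total-map φ (D ∷_) (words (i + h) n)) (rise-zero n) ⟩
    total (weightIfPrefix i) (words (i + h) n) + 0
      ≡⟨ ℕ.+-identityʳ _ ⟩
    total (weightIfPrefix i) (words (i + h) n)
      ≡⟨ total-weightIfPrefix i h n ⟩
    total (wordWeight k) (words h n) ∎
    where
    open ≡-Reasoning
    φ = weightIfPrefix (suc i)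
    -- A word beginning with `U` does not have the nonempty prefix of `D` steps, so only the words
    -- beginning with `D` contribute.
    rise-zero : ∀ n → total φ (riseFirst (suc (i + h)) n) ≡ 0
    rise-zero zero    = refl
    rise-zero (suc n) = begin
      total φ (map (U ∷_) ws ++ [])  ≡⟨ cong (total φ) (++-identityʳ (map (U ∷_) ws)) ⟩
      total φ (map (U ∷_) ws)        ≡⟨ total-map φ (U ∷_) ws ⟩
      total (λ _ → 0) ws             ≡⟨ total-zero ws ⟩
      0                              ∎
      where ws = words (k + suc (i + h)) n

  -- The induction parallels `length-words`. The base weight 3 of an initial `U` gives the term at
  -- height `k + h`; the surplus, once the prefix Dᵏ is deleted, gives the term at height `h`, as a
  -- level step would.
  weight-words : ∀ h n → total (wordWeight k) (words h n) ≡ coeff k 1 3 (suc h) n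
  weight-fallFirst : ∀ h n → total (wordWeight k) (fallFirst h n) ≡ coeff k 1 3 h n
  weight-words h zero = trans (total-++ (wordWeight k) (fallFirst h zero) [])
    (trans (ℕ.+-identityʳ _) (weight-fallFirst h zero))
  weight-words h (suc n) = trans (total-++ (wordWeight k) (fallFirst h (suc n)) _)
    (cong₂ _+_ (weight-fallFirst h (suc n)) (begin
      total (wordWeight k) (map (U ∷_) ws ++ [])
        ≡⟨ cong (total (wordWeight k)) (++-identityʳ (map (U ∷_) ws)) ⟩
      total (wordWeight k) (map (U ∷_) ws)
        ≡⟨ total-map (wordWeight k) (U ∷_) ws ⟩
      total (wordWeight k ∘ (U ∷_)) ws
        ≡⟨ cong sum (map-cong wordWeight-U ws) ⟩
      total (λ w → 3 * wordWeight k w + weightIfPrefix k w) ws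
        ≡⟨ total-linear 3 (wordWeight k) (weightIfPrefix k) ws ⟩
      3 * total (wordWeight k) ws + total (weightIfPrefix k) ws
        ≡⟨ cong₂ (λ x y → 3 * x + y) (weight-words (k + h) n)
             (trans (total-weightIfPrefix k h n) (weight-words h n)) ⟩
      3 * coeff k 1 3 (suc (k + h)) n + coeff k 1 3 (suc h) n
        ≡⟨ swap (coeff k 1 3 (suc (k + h)) n) (coeff k 1 3 (suc h) n) ⟩
      1 * coeff k 1 3 (suc h) n + 3 * coeff k 1 3 (suc (k + h)) n ∎))
    where
    open ≡-Reasoning
    ws = words (k + h) n
    swap : ∀ x y → 3 * x + y ≡ 1 * y + 3 * x
    swap = solve-∀
  weight-fallFirst zero    zero    = refl
  weight-fallFirst zero    (suc n) = refl
  weight-fallFirst (suc h) n       =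
    trans (total-map (wordWeight k) (D ∷_) (words h n)) (weight-words h n)

  weighted-count : ∀ n → HasWeightedCount (Dyck n k) weight (coeff k 1 3 1 n)
  weighted-count n = _ , paths n , trans (sumℕ-lookup (wordWeight k) (words 0 n)) (weight-words 0 n)

-- Specialisation to the four values of the parameters.

proposition4p18 : (k : ℕ) → 1 ≤ k →
    (ν : ℤ → ℤ → ℤ → PowerSeries) → IsNu k ν →
    (S : ℕ → ℤ → ℤ → ℤ) → IsExpansionAt1 ν S →
    (n : ℕ) →
    (Σ[ d ∈ ℕ ] HasCardinality (Dyck n k) d
    × (S n 0ℤ 0ℤ ≡ + d × (+ d) / 1 ≡ fussCatalan k n)
    × (S n 0ℤ 1ℤ ≡ + (2 ^ n * d) × HasCardinality (ColouredDyck n k) (2 ^ n * d)))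
    × (Σ[ h ∈ ℕ ] HasCardinality (SchA n k) h × S n 1ℤ 0ℤ ≡ + h)
    × (Σ[ w ∈ ℕ ] HasWeightedCount (Dyck n k) weight w × S n 1ℤ 1ℤ ≡ + w)
proposition4p18 k _ ν isNu S isExpansion n =
    ( coeff k 0 1 1 n
    , DyckWords.path-count k (λ _ → refl) n
    -- The arguments are m = m′ + 1 and u = u′ + 1, and `c = m * u′ + 1` takes the values 1, 2, 1, 3
    -- at `(m′ , u′)` equal to `(0 , 0)`, `(0 , 1)`, `(1 , 0)`, `(1 , 1)`.
    , ( expansion k 0 1 (ν 1ℤ 1ℤ 1ℤ) (isNu 1ℤ 1ℤ 1ℤ) _ (isExpansion 1ℤ 1ℤ) n
      , ≡-fussCatalan k n _ (coeff-fussCatalan k n))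
    , ( trans (expansion k 0 2 (ν 1ℤ 1ℤ (+ 2)) (isNu 1ℤ 1ℤ (+ 2)) _ (isExpansion 1ℤ (+ 2)) n) (cong +_ scale)
      , subst (HasCardinality (ColouredDyck n k)) scale (ColouredWords.path-count k (λ _ → refl) n)))
  , (_ , SchröderWords.path-count k (SchröderWords.rises-gain k) n
       , expansion k 1 1 (ν (+ 2) 1ℤ 1ℤ) (isNu (+ 2) 1ℤ 1ℤ) _ (isExpansion (+ 2) 1ℤ) n)
  , (_ , WeightedDyck.weighted-count k n
       , expansion k 1 3 (ν (+ 2) 1ℤ (+ 2)) (isNu (+ 2) 1ℤ (+ 2)) _ (isExpansion (+ 2) (+ 2)) n)
  where
  scale : coeff k 0 2 1 n ≡ 2 ^ n * coeff k 0 1 1 n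
  scale = coeff-scale k 2 1 1 n
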